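{- For any triangle-free graph $G$ with $\frac38\leq\alpha(G)\leq\frac12$ we have $$\beta(G)\leq\frac12\,\alpha(G)\left(\frac12-\alpha(G)\right).$$
   Context: All graphs are finite and simple. For a graph $G$ with $n\geq 1$ vertices, $\alpha(G)=\max\{|A|/n : A\subseteq V(G) \text{ an independent set}\}$ is the relative independence number. A half in $G$ is a function $\mu: V(G)\to[0,1]$ such that $\sum_{v\in V(G)}\mu(v)=n/2$. Put $\beta(G,\mu)=\frac1{n^2}\sum_{\{u,v\}\in E(G)}\mu(u)\mu(v)$ (each edge is counted once) and $\beta(G)=\min\{\beta(G,\mu): \mu \text{ is a half in } G\}$. -}

module Defs where

open import Algebra.Bundles using (CommutativeRing)
open import Data.Bool.Base using (Bool; true; false; if_then_else_)
open import Data.Empty using (⊥-elim)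
open import Data.Fin.Base using (Fin; zero; suc; toℕ; fromℕ<)
import Data.Fin.Properties as Fin
open import Data.Fin.Subset using (Subset; _∈_; ∣_∣; ⊥)
import Data.Fin.Subset.Properties as Subset
import Data.Integer.Base as ℤ
open import Data.Integer.Solver using () renaming (module +-*-Solver to ℤS)
open import Data.List.Base using (List; []; _∷_; _++_; map; filter; cartesianProductWith; allFin)
open import Data.List.Membership.Propositional using (lose) renaming (_∈_ to _∈ˡ_)
open import Data.List.Membership.Propositional.Properties
  using (∈-map⁺; ∈-++⁺ˡ; ∈-++⁺ʳ; ∈-filter⁺; ∈-cartesianProductWith⁺; ∈-allFin)
open import Data.List.Relation.Unary.All.Properties using (all-filter)
open import Data.List.Relation.Unary.Any using (here)
open import Data.Nat.Base as ℕ using (ℕ; NonZero)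
import Data.Nat.Properties as ℕ
open import Data.Product.Base using (∃; ∃₂; _×_; _,_; proj₁; proj₂)
open import Data.Rational.Base hiding (NonZero; ∣_∣)
open import Data.Rational.Properties
open import Data.Rational.Solver using (module +-*-Solver)
import Data.Rational.Unnormalised.Base as ℚᵘ
import Data.Rational.Unnormalised.Properties as ℚᵘ
open import Data.Sum.Base using (_⊎_; inj₁; inj₂)
open import Data.Vec.Base using (Vec; []; _∷_; lookup; tabulate)
open import Data.Vec.Functional using (Vector)
open import Data.Vec.Properties using (lookup∘tabulate)
open import Function.Base using (_∘_)
open import Level using (0ℓ)
open import Relation.Binary.Bundles using (DecTotalOrder)
open import Relation.Binary.Core using (Rel)
import Relation.Binary.Definitions as B
open import Relation.Binary.PropositionalEquality
open import Relation.Nullary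
open import Relation.Unary using (Pred) renaming (Decidable to Decidable₁)

open import Algebra.Properties.Semiring.Sum
  (CommutativeRing.semiring +-*-commutativeRing)
open import Data.List.Extrema (DecTotalOrder.totalOrder ≤-decTotalOrder)
  using (argmin; argmax; argmin-all; argmax-all; f[argmin]≤v⁺; v≤f[argmax]⁺)

record Graph (n : ℕ) : Set₁ where
  field
    _~_      : Rel (Fin n) 0ℓ
    _~?_     : B.Decidable _~_
    ~-sym    : B.Symmetric _~_
    ~-irrefl : ∀ {u} → ¬ (u ~ u)

TriangleFree : ∀ {n} → Graph n → Set
TriangleFree G = ∀ {u v w} → u ~ v → v ~ w → ¬ (u ~ w)
  where open Graph G

IsMaximum IsMinimum : {A : Set} → Pred A 0ℓ → (A → ℚ) → ℚ → Set
IsMaximum P f m = (∃ λ a → P a × f a ≡ m) × (∀ a → P a → f a ≤ m)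
IsMinimum P f m = (∃ λ a → P a × f a ≡ m) × (∀ a → P a → m ≤ f a)

Independent : ∀ {n} → Graph n → Subset n → Set
Independent G A = ∀ u v → u ∈ A → v ∈ A → ¬ (u ~ v)
  where open Graph G

density : ∀ {n} .{{_ : NonZero n}} → Subset n → ℚ
density {n} A = ℤ.+ ∣ A ∣ / n

-- Halves take rational values.  The minimum over real-valued halves is the
-- same number: `rounding` below uses only ordered-field arithmetic, and moves
-- any half, without increasing β(G,μ), to one in which all values but one are
-- 0 or 1 and the remaining value is n/2 minus an integer.
IsHalf : ∀ {n} → Vector ℚ n → Set
IsHalf {n} μ = (∀ v → 0ℚ ≤ μ v × μ v ≤ 1ℚ) × sum μ ≡ ℤ.+ n / 2

-- The restriction u < v selects one ordered pair for each edge {u,v}.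
edgeSum : ∀ {n} → Graph n → Vector ℚ n → ℚ
edgeSum {n} G μ =
  ∑[ u < n ] ∑[ v < n ]
    (if does ((u Fin.<? v) ×-dec (u ~? v)) then μ u * μ v else 0ℚ)
  where open Graph G

β[_,_] : ∀ {n} .{{_ : NonZero n}} → Graph n → Vector ℚ n → ℚ
β[_,_] {n} G μ = (_/_ (ℤ.+ 1) (n ℕ.* n) {{ℕ.m*n≢0 n n}}) * edgeSum G μ

private

  words : ∀ n → List (Vec Bool n)
  words ℕ.zero    = [] ∷ []
  words (ℕ.suc n) = map (true ∷_) (words n) ++ map (false ∷_) (words n)

  ∈-words : ∀ {n} (w : Vec Bool n) → w ∈ˡ words n
  ∈-words []          = here refl
  ∈-words (true ∷ w)  = ∈-++⁺ˡ (∈-map⁺ (true ∷_) (∈-words w))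
  ∈-words (false ∷ w) =
    ∈-++⁺ʳ (map (true ∷_) (words _)) (∈-map⁺ (false ∷_) (∈-words w))

  independent? : ∀ {n} (G : Graph n) → Decidable₁ (Independent G)
  independent? G A = Fin.all? λ u → Fin.all? λ v →
    (u Subset.∈? A) →-dec (v Subset.∈? A) →-dec ¬? (Graph._~?_ G u v)

  ⊥-independent : ∀ {n} (G : Graph n) → Independent G ⊥
  ⊥-independent G u v u∈⊥ = ⊥-elim (Subset.∉⊥ u∈⊥)

α-exists : ∀ {n} .{{_ : NonZero n}} (G : Graph n) →
           ∃ (IsMaximum (Independent G) density)
α-exists {n} G = density A , (A , A-ind , refl) , λ B B-ind →
    v≤f[argmax]⁺ {f = density} ⊥ candidates
      (inj₂ (lose (∈-filter⁺ (independent? G) (∈-words B) B-ind) ≤-refl))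
  where
  candidates = filter (independent? G) (words n)
  A = argmax density ⊥ candidates
  A-ind : Independent G A
  A-ind = argmax-all density {P = Independent G} (⊥-independent G)
            (all-filter (independent? G) (words n))

private

  open +-*-Solver

  ≤-by : ∀ {a b c d} → a ≤ b → b - a ≡ d - c → c ≤ d
  ≤-by {a} {b} {c} {d} a≤b eq =
    subst₂ _≤_
      (solve 2 (λ a c → a :+ (c :- a) := c) refl a c)
      (trans (solve 3 (λ a b c → b :+ (c :- a) := (b :- a) :+ c) refl a b c)
        (trans (cong (_+ c) eq)
          (solve 2 (λ c d → (d :- c) :+ c := d) refl c d)))
      (+-monoˡ-≤ (c - a) a≤b)

  half-suc : ∀ n → ½ + (ℤ.+ n / 2) ≡ ℤ.+ ℕ.suc n / 2
  half-suc n = toℚᵘ-injective (begin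
    toℚᵘ (½ + (ℤ.+ n / 2))              ≈⟨ toℚᵘ-homo-+ ½ (ℤ.+ n / 2) ⟩
    toℚᵘ ½ ℚᵘ.+ toℚᵘ (ℤ.+ n / 2)        ≈⟨ ℚᵘ.+-congʳ (toℚᵘ ½) (toℚᵘ-fromℚᵘ (ℚᵘ.mkℚᵘ (ℤ.+ n) 1)) ⟩
    ℚᵘ.½ ℚᵘ.+ ℚᵘ.mkℚᵘ (ℤ.+ n) 1         ≈⟨ ℚᵘ.*≡* (ℤS.solve 1
      (λ n → (ℤS.con (ℤ.+ 1) ℤS.:* ℤS.con (ℤ.+ 2) ℤS.:+ n ℤS.:* ℤS.con (ℤ.+ 2))
               ℤS.:* ℤS.con (ℤ.+ 2)
             ℤS.:= (ℤS.con (ℤ.+ 1) ℤS.:+ n) ℤS.:* ℤS.con (ℤ.+ 4)) refl (ℤ.+ n)) ⟩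
    ℚᵘ.mkℚᵘ (ℤ.+ ℕ.suc n) 1             ≈⟨ toℚᵘ-fromℚᵘ (ℚᵘ.mkℚᵘ (ℤ.+ ℕ.suc n) 1) ⟨
    toℚᵘ (ℤ.+ ℕ.suc n / 2)              ∎)
    where
    open ℚᵘ.≃-Reasoning
  sum-½ : ∀ n → sum {n} (λ _ → ½) ≡ ℤ.+ n / 2
  sum-½ ℕ.zero    = refl
  sum-½ (ℕ.suc n) = trans (cong (½ +_) (sum-½ n)) (half-suc n)

  ½-half : ∀ n → IsHalf {n} (λ _ → ½)
  ½-half n = (λ _ → *≤* (ℤ.+≤+ ℕ.z≤n) , *≤* (ℤ.+≤+ (ℕ.s≤s ℕ.z≤n))) , sum-½ n

  half? : ∀ {n} → Decidable₁ (IsHalf {n})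
  half? {n} μ =
    Fin.all? (λ v → (0ℚ ≤? μ v) ×-dec (μ v ≤? 1ℚ)) ×-dec (sum μ ≟ ℤ.+ n / 2)

  sum-*ˡ : ∀ {n} c (f : Vector ℚ n) → sum (λ i → c * f i) ≡ c * sum f
  sum-*ˡ c f = sym (*-distribˡ-sum c f)

  sum-nonPos : ∀ {n} (f : Vector ℚ n) → (∀ i → f i ≤ 0ℚ) → sum f ≤ 0ℚ
  sum-nonPos {ℕ.zero}  f f≤0 = ≤-refl
  sum-nonPos {ℕ.suc n} f f≤0 =
    +-mono-≤ (f≤0 zero) (sum-nonPos (f ∘ suc) (f≤0 ∘ suc))

  ∑∑ : ∀ {n} → (Fin n → Fin n → ℚ) → ℚ
  ∑∑ f = sum (λ i → sum (f i))

  ∑∑-cong : ∀ {n} {f g : Fin n → Fin n → ℚ} →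
            (∀ i j → f i j ≡ g i j) → ∑∑ f ≡ ∑∑ g
  ∑∑-cong f≗g = sum-cong-≗ λ i → sum-cong-≗ (f≗g i)

  ∑∑-+ : ∀ {n} (f g : Fin n → Fin n → ℚ) →
         ∑∑ (λ i j → f i j + g i j) ≡ ∑∑ f + ∑∑ g
  ∑∑-+ f g = trans (sum-cong-≗ λ i → ∑-distrib-+ (f i) (g i))
                   (∑-distrib-+ (sum ∘ f) (sum ∘ g))

  ∑∑-* : ∀ {n} c (f : Fin n → Fin n → ℚ) →
         ∑∑ (λ i j → c * f i j) ≡ c * ∑∑ f
  ∑∑-* c f = trans (sum-cong-≗ λ i → sum-*ˡ c (f i)) (sum-*ˡ c (sum ∘ f))

  δ : ∀ {n} → Fin n → Fin n → ℚ
  δ zero    zero    = 1ℚ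
  δ zero    (suc j) = 0ℚ
  δ (suc i) zero    = 0ℚ
  δ (suc i) (suc j) = δ i j

  δ-refl : ∀ {n} (i : Fin n) → δ i i ≡ 1ℚ
  δ-refl zero    = refl
  δ-refl (suc i) = δ-refl i

  δ-≢ : ∀ {n} {i j : Fin n} → i ≢ j → δ i j ≡ 0ℚ
  δ-≢ {i = zero}  {zero}  i≢j = ⊥-elim (i≢j refl)
  δ-≢ {i = zero}  {suc j} i≢j = refl
  δ-≢ {i = suc i} {zero}  i≢j = refl
  δ-≢ {i = suc i} {suc j} i≢j = δ-≢ (i≢j ∘ cong suc)

  sum-δ : ∀ {n} (i : Fin n) → sum (δ i) ≡ 1ℚ
  sum-δ {ℕ.suc n} zero = cong (1ℚ +_) (sum-replicate-zero n)
  sum-δ (suc i) = trans (+-identityˡ (sum (δ i))) (sum-δ i)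

  Δ : ∀ {n} → Fin n → Fin n → Vector ℚ n
  Δ u v i = δ u i - δ v i

  Δ-fst : ∀ {n} {u v : Fin n} → u ≢ v → Δ u v u ≡ 1ℚ
  Δ-fst {u = u} u≢v = cong₂ _-_ (δ-refl u) (δ-≢ (u≢v ∘ sym))

  Δ-snd : ∀ {n} {u v : Fin n} → u ≢ v → Δ u v v ≡ - 1ℚ
  Δ-snd {v = v} u≢v = cong₂ _-_ (δ-≢ u≢v) (δ-refl v)

  Δ-else : ∀ {n} {u v i : Fin n} → u ≢ i → v ≢ i → Δ u v i ≡ 0ℚ
  Δ-else u≢i v≢i = cong₂ _-_ (δ-≢ u≢i) (δ-≢ v≢i)

  sum-Δ : ∀ {n} (u v : Fin n) → sum (Δ u v) ≡ 0ℚ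
  sum-Δ u v = trans
    (sum-cong-≗ λ i → solve 2 (λ x y → x :- y := x :+ con (- 1ℚ) :* y) refl (δ u i) (δ v i))
    (trans (∑-distrib-+ (δ u) (λ i → - 1ℚ * δ v i))
      (cong₂ _+_ (sum-δ u) (trans (sum-*ˡ (- 1ℚ) (δ v)) (cong (- 1ℚ *_) (sum-δ v)))))

  shift : ∀ {n} → Vector ℚ n → ℚ → Fin n → Fin n → Vector ℚ n
  shift μ t u v i = μ i + t * Δ u v i

  sum-shift : ∀ {n} (μ : Vector ℚ n) t u v → sum (shift μ t u v) ≡ sum μ
  sum-shift μ t u v = trans (∑-distrib-+ μ (λ i → t * Δ u v i))
    (trans (cong (sum μ +_) (trans (sum-*ˡ t (Δ u v)) (trans (cong (t *_) (sum-Δ u v)) (*-zeroʳ t))))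
      (+-identityʳ (sum μ)))

  module _ {n} (G : Graph n) where

    wt : Fin n → Fin n → ℚ
    wt u v = if does ((u Fin.<? v) ×-dec Graph._~?_ G u v) then 1ℚ else 0ℚ

    form : Vector ℚ n → Vector ℚ n → ℚ
    form μ ν = ∑∑ λ u v → wt u v * (μ u * ν v)

    edgeSum≡form : ∀ μ → edgeSum G μ ≡ form μ μ
    edgeSum≡form μ = ∑∑-cong λ u v →
      if-* (does ((u Fin.<? v) ×-dec Graph._~?_ G u v)) (μ u * μ v)
      where
      if-* : ∀ b x → (if b then x else 0ℚ) ≡ (if b then 1ℚ else 0ℚ) * x
      if-* true  x = sym (*-identityˡ x)
      if-* false x = sym (*-zeroˡ x)

    edgeSum-cong : ∀ {μ ν} → (∀ i → μ i ≡ ν i) → edgeSum G μ ≡ edgeSum G ν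
    edgeSum-cong {μ} {ν} μ≗ν = trans (edgeSum≡form μ) (trans
      (∑∑-cong λ u v → cong (wt u v *_) (cong₂ _*_ (μ≗ν u) (μ≗ν v)))
      (sym (edgeSum≡form ν)))

    slope : Vector ℚ n → Fin n → Fin n → ℚ
    slope μ u v = ∑∑ λ i j → wt i j * (μ i * Δ u v j + Δ u v i * μ j)

    slope-swap : ∀ μ u v → slope μ v u ≡ - 1ℚ * slope μ u v
    slope-swap μ u v = trans
      (∑∑-cong λ i j → solve 7
        (λ w x y a b c d → w :* (x :* (d :- c) :+ (b :- a) :* y)
          := con (- 1ℚ) :* (w :* (x :* (c :- d) :+ (a :- b) :* y)))
        refl (wt i j) (μ i) (μ j) (δ u i) (δ v i) (δ u j) (δ v j))
      (∑∑-* (- 1ℚ) λ i j → wt i j * (μ i * Δ u v j + Δ u v i * μ j))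

    edgeSum-shift : ∀ μ t u v → edgeSum G (shift μ t u v) ≡
      edgeSum G μ + (t * slope μ u v + (t * t) * form (Δ u v) (Δ u v))
    edgeSum-shift μ t u v = trans (edgeSum≡form (shift μ t u v)) (trans
      (∑∑-cong λ i j → solve 6
        (λ w x y a b t → w :* ((x :+ t :* a) :* (y :+ t :* b))
          := w :* (x :* y) :+ (t :* (w :* (x :* b :+ a :* y)) :+ (t :* t) :* (w :* (a :* b))))
        refl (wt i j) (μ i) (μ j) (Δ u v i) (Δ u v j) t)
      (trans (∑∑-+ f (λ i j → t * g i j + (t * t) * h i j))
        (cong₂ _+_ (sym (edgeSum≡form μ))
          (trans (∑∑-+ (λ i j → t * g i j) (λ i j → (t * t) * h i j))
            (cong₂ _+_ (∑∑-* t g) (∑∑-* (t * t) h))))))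
      where
      f g h : Fin n → Fin n → ℚ
      f i j = wt i j * (μ i * μ j)
      g i j = wt i j * (μ i * Δ u v j + Δ u v i * μ j)
      h i j = wt i j * (Δ u v i * Δ u v j)

    wt-irrefl : ∀ u → wt u u ≡ 0ℚ
    wt-irrefl u = no-edge ((u Fin.<? u) ×-dec Graph._~?_ G u u) λ (_ , u~u) → Graph.~-irrefl G u~u
      where
      no-edge : {P : Set} (P? : Dec P) → ¬ P → (if does P? then 1ℚ else 0ℚ) ≡ 0ℚ
      no-edge (yes p) ¬p = ⊥-elim (¬p p)
      no-edge (no _)  _  = refl

    wt-cases : ∀ u v → wt u v ≡ 0ℚ ⊎ wt u v ≡ 1ℚ
    wt-cases u v = cases (does ((u Fin.<? v) ×-dec Graph._~?_ G u v))
      where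
      cases : ∀ b → (if b then 1ℚ else 0ℚ) ≡ 0ℚ ⊎ (if b then 1ℚ else 0ℚ) ≡ 1ℚ
      cases true  = inj₂ refl
      cases false = inj₁ refl

    wt*-nonPos : ∀ i j {x} → x ≤ 0ℚ → wt i j * x ≤ 0ℚ
    wt*-nonPos i j {x} x≤0 with wt-cases i j
    ... | inj₁ w≡0 = ≤-reflexive (trans (cong (_* x) w≡0) (*-zeroˡ x))
    ... | inj₂ w≡1 = ≤-trans (≤-reflexive (trans (cong (_* x) w≡1) (*-identityˡ x))) x≤0

    -1≤0 : - 1ℚ ≤ 0ℚ
    -1≤0 = *≤* ℤ.-≤+

    curvature : ∀ {u v} → u ≢ v → form (Δ u v) (Δ u v) ≤ 0ℚ
    curvature {u} {v} u≢v = sum-nonPos _ λ i → sum-nonPos _ λ j → term i j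
      where
      zeroˡ : ∀ {x y} → x ≡ 0ℚ → x * y ≤ 0ℚ
      zeroˡ {y = y} x≡0 = ≤-reflexive (trans (cong (_* y) x≡0) (*-zeroˡ y))
      zeroʳ : ∀ {x y} → y ≡ 0ℚ → x * y ≤ 0ℚ
      zeroʳ {x} y≡0 = ≤-reflexive (trans (cong (x *_) y≡0) (*-zeroʳ x))
      term : ∀ i j → wt i j * (Δ u v i * Δ u v j) ≤ 0ℚ
      term i j with i Fin.≟ j
      ... | yes refl = zeroˡ (wt-irrefl i)
      ... | no i≢j with u Fin.≟ i | v Fin.≟ i | u Fin.≟ j | v Fin.≟ j
      ... | no u≢i   | no v≢i   | _        | _        = wt*-nonPos i j (zeroˡ (Δ-else u≢i v≢i))
      ... | _        | _        | no u≢j   | no v≢j   = wt*-nonPos i j (zeroʳ {Δ u v i} (Δ-else u≢j v≢j))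
      ... | yes refl | _        | yes refl | _        = ⊥-elim (i≢j refl)
      ... | _        | yes refl | _        | yes refl = ⊥-elim (i≢j refl)
      ... | yes refl | _        | _        | yes refl = wt*-nonPos i j
        (≤-trans (≤-reflexive (cong₂ _*_ (Δ-fst u≢v) (Δ-snd u≢v))) -1≤0)
      ... | _        | yes refl | yes refl | _        = wt*-nonPos i j
        (≤-trans (≤-reflexive (cong₂ _*_ (Δ-snd u≢v) (Δ-fst u≢v))) -1≤0)

    descend : ∀ {μ t u v} → u ≢ v → 0ℚ ≤ t → slope μ u v ≤ 0ℚ →
              edgeSum G (shift μ t u v) ≤ edgeSum G μ
    descend {μ} {t} {u} {v} u≢v 0≤t s≤0 = ≤-trans
      (≤-reflexive (edgeSum-shift μ t u v))
      (≤-trans (+-monoʳ-≤ (edgeSum G μ) (+-mono-≤ (*-nonPos 0≤t s≤0)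
        (*-nonPos (≤-trans (≤-reflexive (sym (*-zeroʳ t))) (*-monoˡ-≤-nonNeg t {{nonNegative 0≤t}} 0≤t))
          (curvature u≢v))))
        (≤-reflexive (+-identityʳ (edgeSum G μ))))
      where
      *-nonPos : ∀ {t x} → 0ℚ ≤ t → x ≤ 0ℚ → t * x ≤ 0ℚ
      *-nonPos {t} 0≤t x≤0 =
        ≤-trans (*-monoˡ-≤-nonNeg t {{nonNegative 0≤t}} x≤0) (≤-reflexive (*-zeroʳ t))

  shift-else : ∀ {n} {μ : Vector ℚ n} t {u v i} → u ≢ i → v ≢ i → shift μ t u v i ≡ μ i
  shift-else {μ = μ} t {i = i} u≢i v≢i = trans (cong (λ d → μ i + t * d) (Δ-else u≢i v≢i))
    (trans (cong (μ i +_) (*-zeroʳ t)) (+-identityʳ (μ i)))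

  Integral : ℚ → Set
  Integral x = x ≡ 0ℚ ⊎ x ≡ 1ℚ

  -- The furthest feasible shift makes one of the two values integral.
  reach : ∀ {n} {μ : Vector ℚ n} {u v} → IsHalf μ → u ≢ v →
          ∃ λ t → 0ℚ ≤ t × IsHalf (shift μ t u v) ×
            (Integral (shift μ t u v u) ⊎ Integral (shift μ t u v v))
  reach {n} {μ} {u} {v} (μ∈ , ∑μ) u≢v = body (≤-total (1ℚ - μ u) (μ v))
    where
    at-u : ∀ t → shift μ t u v u ≡ μ u + t
    at-u t = trans (cong (λ d → μ u + t * d) (Δ-fst u≢v)) (cong (μ u +_) (*-identityʳ t))
    at-v : ∀ t → shift μ t u v v ≡ μ v - t
    at-v t = trans (cong (λ d → μ v + t * d) (Δ-snd u≢v))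
      (solve 2 (λ m t → m :+ t :* con (- 1ℚ) := m :- t) refl (μ v) t)
    half : ∀ t → 0ℚ ≤ t → t ≤ 1ℚ - μ u → t ≤ μ v → IsHalf (shift μ t u v)
    half t 0≤t t≤ t≤μv = bounds , trans (sum-shift μ t u v) ∑μ
      where
      Unit : ℚ → Set
      Unit x = 0ℚ ≤ x × x ≤ 1ℚ
      bounds : ∀ i → Unit (shift μ t u v i)
      bounds i with u Fin.≟ i | v Fin.≟ i
      ... | yes refl | _ = subst Unit (sym (at-u t))
        ( +-mono-≤ (proj₁ (μ∈ u)) 0≤t
        , ≤-by t≤ (solve 2 (λ m t → (con 1ℚ :- m) :- t := con 1ℚ :- (m :+ t)) refl (μ u) t))
      ... | no _ | yes refl = subst Unit (sym (at-v t))
        ( ≤-by t≤μv (solve 2 (λ m t → m :- t := (m :- t) :- con 0ℚ) refl (μ v) t)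
        , +-mono-≤ (proj₂ (μ∈ v)) (neg-antimono-≤ 0≤t))
      ... | no u≢i | no v≢i = subst Unit (sym (shift-else {μ = μ} t u≢i v≢i)) (μ∈ i)
    body : 1ℚ - μ u ≤ μ v ⊎ μ v ≤ 1ℚ - μ u →
           ∃ λ t → 0ℚ ≤ t × IsHalf (shift μ t u v) ×
             (Integral (shift μ t u v u) ⊎ Integral (shift μ t u v v))
    body (inj₁ le) = 1ℚ - μ u
      , 0≤1-μu
      , half (1ℚ - μ u) 0≤1-μu ≤-refl le
      , inj₁ (inj₂ (trans (at-u (1ℚ - μ u))
          (solve 1 (λ m → m :+ (con 1ℚ :- m) := con 1ℚ) refl (μ u))))
      where
      0≤1-μu : 0ℚ ≤ 1ℚ - μ u
      0≤1-μu = ≤-by (proj₂ (μ∈ u)) (solve 1 (λ m → con 1ℚ :- m := (con 1ℚ :- m) :- con 0ℚ) refl (μ u))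
    body (inj₂ le) = μ v , proj₁ (μ∈ v) , half (μ v) (proj₁ (μ∈ v)) le ≤-refl
      , inj₂ (inj₁ (trans (at-v (μ v)) (+-inverseʳ (μ v))))

  exchange : ∀ {n} (G : Graph n) {μ u v} → IsHalf μ → u ≢ v →
    ∃ λ ν → IsHalf ν × edgeSum G ν ≤ edgeSum G μ ×
      (∀ {i} → u ≢ i → v ≢ i → ν i ≡ μ i) × (Integral (ν u) ⊎ Integral (ν v))
  exchange G {μ} {u} {v} hμ u≢v with ≤-total (slope G μ u v) 0ℚ
  ... | inj₁ s≤0 =
    let t , 0≤t , hν , int = reach hμ u≢v in
    shift μ t u v , hν , descend G {μ} u≢v 0≤t s≤0
      , (λ u≢i v≢i → shift-else {μ = μ} t u≢i v≢i) , int
  ... | inj₂ 0≤s =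
    let t , 0≤t , hν , int = reach hμ (u≢v ∘ sym) in
    shift μ t v u , hν , descend G {μ} (u≢v ∘ sym) 0≤t s≤0
      , (λ u≢i v≢i → shift-else {μ = μ} t v≢i u≢i) , swap int
    where
    open import Data.Sum.Base using (swap)
    s≤0 : slope G μ v u ≤ 0ℚ
    s≤0 = ≤-trans (≤-reflexive (slope-swap G μ u v))
      (*-monoˡ-≤-nonPos (- 1ℚ) 0≤s)

  roundBelow : ∀ {n} .{{_ : NonZero n}} (G : Graph n) {μ} → IsHalf μ → ∀ m → m ℕ.≤ n →
    ∃₂ λ ν k → IsHalf ν × edgeSum G ν ≤ edgeSum G μ ×
      (∀ i → toℕ i ℕ.< m → i ≢ k → Integral (ν i))
  roundBelow {ℕ.suc n} G {μ} hμ ℕ.zero _ = μ , zero , hμ , ≤-refl , λ _ ()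
  roundBelow {n} G {μ} hμ (ℕ.suc m) m<n
    with roundBelow G hμ m (ℕ.<⇒≤ m<n)
  ... | ν , k , hν , ν≤μ , int = next (k Fin.≟ j)
    where
    j : Fin n
    j = fromℕ< m<n
    below : ∀ {i} → toℕ i ℕ.< ℕ.suc m → j ≢ i → toℕ i ℕ.< m
    below {i} i<1+m j≢i = ℕ.≤∧≢⇒< (ℕ.s≤s⁻¹ i<1+m)
      λ i≡m → j≢i (Fin.toℕ-injective (trans (Fin.toℕ-fromℕ< m<n) (sym i≡m)))
    next : Dec (k ≡ j) →
      ∃₂ λ ν k → IsHalf ν × edgeSum G ν ≤ edgeSum G μ ×
        (∀ i → toℕ i ℕ.< ℕ.suc m → i ≢ k → Integral (ν i))
    next (yes k≡j) = ν , k , hν , ν≤μ , λ i i< i≢k →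
      int i (below i< λ j≡i → i≢k (sym (trans k≡j j≡i))) i≢k
    next (no k≢j) with exchange G hν k≢j
    ... | ν′ , hν′ , ν′≤ν , same , inj₁ int-k =
      ν′ , j , hν′ , ≤-trans ν′≤ν ν≤μ , go
      where
      go : ∀ i → toℕ i ℕ.< ℕ.suc m → i ≢ j → Integral (ν′ i)
      go i i< i≢j with k Fin.≟ i
      ... | yes refl = int-k
      ... | no k≢i = subst Integral (sym (same k≢i (i≢j ∘ sym)))
                       (int i (below i< (i≢j ∘ sym)) (k≢i ∘ sym))
    ... | ν′ , hν′ , ν′≤ν , same , inj₂ int-j =
      ν′ , k , hν′ , ≤-trans ν′≤ν ν≤μ , go
      where
      go : ∀ i → toℕ i ℕ.< ℕ.suc m → i ≢ k → Integral (ν′ i)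
      go i i< i≢k with j Fin.≟ i
      ... | yes refl = int-j
      ... | no j≢i = subst Integral (sym (same (i≢k ∘ sym) j≢i))
                       (int i (below i< j≢i) i≢k)

  bit : ∀ {n} → Vec Bool n → Vector ℚ n
  bit w i = if lookup w i then 1ℚ else 0ℚ

  candidate : ∀ {n} → Fin n → Vec Bool n → Vector ℚ n
  candidate {n} k w i = bit w i + ((ℤ.+ n / 2) - sum (bit w)) * δ k i

  rounding : ∀ {n} .{{_ : NonZero n}} (G : Graph n) {μ} → IsHalf μ →
    ∃₂ λ k w → IsHalf (candidate k w) × edgeSum G (candidate k w) ≤ edgeSum G μ
  rounding {n} G {μ} hμ with roundBelow G hμ n ℕ.≤-refl
  ... | ν , k , (ν∈ , ∑ν) , ν≤μ , int = k , w
      , ( (λ i → subst (λ x → 0ℚ ≤ x × x ≤ 1ℚ) (ν≗ i) (ν∈ i))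
        , trans (sym (sum-cong-≗ ν≗)) ∑ν)
      , ≤-trans (≤-reflexive (sym (edgeSum-cong G ν≗))) ν≤μ
    where
    w : Vec Bool n
    w = tabulate λ i → does (ν i ≟ 1ℚ)
    bit-w : ∀ i → i ≢ k → ν i ≡ bit w i
    bit-w i i≢k = trans (lem (ν i) (int i (Fin.toℕ<n i) i≢k))
      (cong (if_then 1ℚ else 0ℚ) (sym (lookup∘tabulate (λ i → does (ν i ≟ 1ℚ)) i)))
      where
      lem : ∀ x → Integral x → x ≡ (if does (x ≟ 1ℚ) then 1ℚ else 0ℚ)
      lem _ (inj₁ refl) = refl
      lem _ (inj₂ refl) = refl
    c : ℚ
    c = ν k - bit w k
    ν≗c : ∀ i → ν i ≡ bit w i + c * δ k i
    ν≗c i with k Fin.≟ i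
    ... | yes refl = trans
      (solve 2 (λ x y → x := y :+ (x :- y) :* con 1ℚ) refl (ν k) (bit w k))
      (cong (λ d → bit w k + c * d) (sym (δ-refl k)))
    ... | no k≢i = trans (bit-w i (k≢i ∘ sym)) (trans
      (solve 2 (λ y c → y := y :+ c :* con 0ℚ) refl (bit w i) c)
      (cong (λ d → bit w i + c * d) (sym (δ-≢ k≢i))))
    c≡ : c ≡ (ℤ.+ n / 2) - sum (bit w)
    c≡ = trans (solve 2 (λ c s → c := (s :+ c) :- s) refl c (sum (bit w)))
      (cong (_- sum (bit w)) (trans (sym (trans (sum-cong-≗ ν≗c)
        (trans (∑-distrib-+ (bit w) (λ i → c * δ k i))
          (cong (sum (bit w) +_) (trans (sum-*ˡ c (δ k))
            (trans (cong (c *_) (sum-δ k)) (*-identityʳ c))))))) ∑ν))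
    ν≗ : ∀ i → ν i ≡ candidate k w i
    ν≗ i = trans (ν≗c i) (cong (λ c → bit w i + c * δ k i) c≡)

β-exists : ∀ {n} .{{_ : NonZero n}} (G : Graph n) →
           ∃ (IsMinimum IsHalf β[ G ,_])
β-exists {n} G = β[ G , best ] , (best , best-half , refl) , λ μ hμ →
    let k , w , hc , c≤μ = rounding G hμ in
    f[argmin]≤v⁺ {f = β[ G ,_]} (λ _ → ½) candidates
      (inj₂ (lose (∈-filter⁺ half? (∈-cartesianProductWith⁺ candidate (∈-allFin k) (∈-words w)) hc)
        (*-monoˡ-≤-nonNeg (_/_ (ℤ.+ 1) (n ℕ.* n) {{ℕ.m*n≢0 n n}})
          {{normalize-nonNeg 1 (n ℕ.* n) {{ℕ.m*n≢0 n n}}}} c≤μ)))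
  where
  all-candidates = cartesianProductWith candidate (allFin n) (words n)
  candidates = filter half? all-candidates
  best : Vector ℚ n
  best = argmin β[ G ,_] (λ _ → ½) candidates
  best-half : IsHalf best
  best-half = argmin-all β[ G ,_] {P = IsHalf} (½-half n)
                (all-filter half? all-candidates)

α β : ∀ {n} .{{_ : NonZero n}} → Graph n → ℚ
α G = proj₁ (α-exists G)
β G = proj₁ (β-exists G)

{-# OPTIONS --safe #-}
module Submission where

-- Let A be a maximum independent set, k = |A|, m = n/2 − k, and let a(u) be
-- the number of neighbours of u in A.  An edge uv gives a(u) + a(v) ≤ k, so
-- the vertices outside A with a(u) > k/2 are independent, and the set X of the
-- other vertices outside A has size at least n − 2k = 2m.  Put
-- h(u) = k − 2a(u), which is nonnegative on X.  If U ⊆ X has |U| ≥ m and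
-- 2e(U) ≤ ∑_U h, then A together with U scaled down to weight m is a half of
-- the required sparsity.  If some w has d(w) = |X ∩ N(w)| ≥ m, then
-- U = X ∩ N(w) is independent and works.  Otherwise U = X ∖ N(w) has size at
-- least m for every w, and it works for some w, since over w ∈ A
--   ∑_w 2e(X ∖ N(w)) = ∑_X d h   and   ∑_w ∑_{X ∖ N(w)} h = ∑_X (k − a) h,
-- where d ≤ m ≤ k/2 ≤ k − a on X.

open import Defs
open import Data.Nat.Base using (ℕ; NonZero)
open import Data.Integer.Base using (+_)
open import Data.Rational.Base using (_≤_; _*_; _-_; _/_; ½)

open import Algebra.Bundles using (CommutativeRing)
open import Data.Bool.Base using (Bool; true; false; if_then_else_; not; _∧_)
open import Data.Empty using (⊥-elim)
open import Data.Fin.Base using (Fin; zero; suc)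
import Data.Fin.Base as Fin
import Data.Fin.Properties as Fin
open import Data.Fin.Subset using (Subset; _∈_; ∣_∣)
import Data.Integer.Base as ℤ
import Data.Integer.Properties as ℤ
import Data.Nat.Base as ℕ
import Data.Nat.Properties as ℕ
open import Data.Product.Base using (∃; _×_; _,_; proj₁; proj₂)
open import Data.Rational.Base
  using (ℚ; 0ℚ; 1ℚ; _+_; -_; _<_; nonNegative; positive; 1/_; ≢-nonZero; toℚᵘ)
open import Data.Rational.Properties
open import Data.Rational.Solver using (module +-*-Solver)
import Data.Rational.Unnormalised.Base as ℚᵘ
import Data.Rational.Unnormalised.Properties as ℚᵘ
open import Data.Sum.Base using (_⊎_; inj₁; inj₂)
open import Data.Vec.Base using ([]; _∷_; lookup; tabulate)
open import Data.Vec.Functional using (Vector)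
open import Data.Vec.Properties using (lookup∘tabulate; []=⇒lookup; lookup⇒[]=)
open import Function.Base using (_∘_)
open import Relation.Binary.PropositionalEquality
open import Relation.Nullary

open import Algebra.Properties.Semiring.Sum
  (CommutativeRing.semiring +-*-commutativeRing)

open +-*-Solver using (solve; con; _:=_; _:+_; _:*_; _:-_)

-- Order on the rationals

0≤⇒≤ : ∀ {p q} → 0ℚ ≤ q - p → p ≤ q
0≤⇒≤ {p} {q} 0≤q-p = subst₂ _≤_ (+-identityˡ p)
  (solve 2 (λ p q → (q :- p) :+ p := q) refl p q) (+-monoˡ-≤ p 0≤q-p)

≤⇒0≤ : ∀ {p q} → p ≤ q → 0ℚ ≤ q - p
≤⇒0≤ {p} {q} p≤q = subst (_≤ q - p) (+-inverseʳ p) (+-monoˡ-≤ (- p) p≤q)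

-- Inequalities below are certified by writing the difference of the two sides as a visibly
-- nonnegative `r`; the identity is mostly left to the ring solver.
≤-via : ∀ {r p q} → 0ℚ ≤ r → r ≡ q - p → p ≤ q
≤-via 0≤r r≡q-p = 0≤⇒≤ (subst (0ℚ ≤_) r≡q-p 0≤r)

0≤+ : ∀ {p q} → 0ℚ ≤ p → 0ℚ ≤ q → 0ℚ ≤ p + q
0≤+ = +-mono-≤

0≤* : ∀ {p q} → 0ℚ ≤ p → 0ℚ ≤ q → 0ℚ ≤ p * q
0≤* {p} {q} 0≤p 0≤q = subst (_≤ p * q) (*-zeroʳ p) (*-monoˡ-≤-nonNeg p {{nonNegative 0≤p}} 0≤q)

0≤1 : 0ℚ ≤ 1ℚ
0≤1 = nonNegative⁻¹ 1ℚ

0≤½ : 0ℚ ≤ ½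
0≤½ = nonNegative⁻¹ ½

-- The factor that shrinks a set of total weight `s` to weight `m`. If `s` is zero, then `m` is
-- squeezed to zero and the factor 0 serves; otherwise it is the quotient.
scaling : ∀ {m s} → 0ℚ ≤ m → m ≤ s → ∃ λ c → 0ℚ ≤ c × c ≤ 1ℚ × c * s ≡ m
scaling {m} {s} 0≤m m≤s with s ≟ 0ℚ
... | yes s≡0 = 0ℚ , ≤-refl , 0≤1 ,
  trans (*-zeroˡ s) (≤-antisym 0≤m (subst (m ≤_) s≡0 m≤s))
... | no s≢0 = c , 0≤c , c≤1 , c*s≡m
  where
  instance
    s-pos = nonNeg∧nonZero⇒pos s {{nonNegative (≤-trans 0≤m m≤s)}} {{≢-nonZero s≢0}}
    s-nonZero = pos⇒nonZero s
  c = m * 1/ s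
  c*s≡m : c * s ≡ m
  c*s≡m = trans (*-assoc m (1/ s) s) (trans (cong (m *_) (*-inverseˡ s)) (*-identityʳ m))
  0≤c : 0ℚ ≤ c
  0≤c = 0≤* 0≤m (<⇒≤ (positive⁻¹ (1/ s) {{1/pos⇒pos s}}))
  c≤1 : c ≤ 1ℚ
  c≤1 = *-cancelʳ-≤-pos s (subst₂ _≤_ (sym c*s≡m) (sym (*-identityˡ s)) m≤s)

-- Natural numbers and fractions as rationals

⟦_⟧ : ℕ → ℚ
⟦ k ⟧ = + k / 1

-- Identities between fractions are checked on unnormalised rationals, where no common factor is
-- cancelled and equality is cross-multiplication.
toℚᵘ-/ : ∀ a b → toℚᵘ (+ a / ℕ.suc b) ℚᵘ.≃ ℚᵘ.mkℚᵘ (+ a) b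
toℚᵘ-/ a b = toℚᵘ-fromℚᵘ (ℚᵘ.mkℚᵘ (+ a) b)

/-*-cancel : ∀ a b .{{_ : NonZero b}} → (+ a / b) * ⟦ b ⟧ ≡ ⟦ a ⟧
/-*-cancel a b@(ℕ.suc b-1) = toℚᵘ-injective (begin
  toℚᵘ ((+ a / b) * ⟦ b ⟧)              ≈⟨ toℚᵘ-homo-* (+ a / b) ⟦ b ⟧ ⟩
  toℚᵘ (+ a / b) ℚᵘ.* toℚᵘ ⟦ b ⟧        ≈⟨ ℚᵘ.*-cong (toℚᵘ-/ a b-1) (toℚᵘ-/ b 0) ⟩
  ℚᵘ.mkℚᵘ (+ a) b-1 ℚᵘ.* ℚᵘ.mkℚᵘ (+ b) 0 ≈⟨ ℚᵘ.*≡* cross ⟩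
  ℚᵘ.mkℚᵘ (+ a) 0                       ≈⟨ toℚᵘ-/ a 0 ⟨
  toℚᵘ ⟦ a ⟧                            ∎)
  where
  open ℚᵘ.≃-Reasoning
  cross : (+ a ℤ.* + b) ℤ.* + 1 ≡ + a ℤ.* + ℕ.suc (b-1 ℕ.* 1)
  cross = trans (ℤ.*-identityʳ (+ a ℤ.* + b))
    (cong (λ m → + a ℤ.* + ℕ.suc m) (sym (ℕ.*-identityʳ b-1)))

⟦⟧-suc : ∀ k → 1ℚ + ⟦ k ⟧ ≡ ⟦ ℕ.suc k ⟧
⟦⟧-suc k = toℚᵘ-injective (begin
  toℚᵘ (1ℚ + ⟦ k ⟧)              ≈⟨ toℚᵘ-homo-+ 1ℚ ⟦ k ⟧ ⟩
  ℚᵘ.1ℚᵘ ℚᵘ.+ toℚᵘ ⟦ k ⟧         ≈⟨ ℚᵘ.+-congʳ ℚᵘ.1ℚᵘ (toℚᵘ-/ k 0) ⟩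
  ℚᵘ.1ℚᵘ ℚᵘ.+ ℚᵘ.mkℚᵘ (+ k) 0    ≈⟨ ℚᵘ.*≡* (cong (λ m → (+ 1 ℤ.+ m) ℤ.* + 1) (ℤ.*-identityʳ (+ k))) ⟩
  ℚᵘ.mkℚᵘ (+ ℕ.suc k) 0          ≈⟨ toℚᵘ-/ (ℕ.suc k) 0 ⟨
  toℚᵘ ⟦ ℕ.suc k ⟧               ∎)
  where
  open ℚᵘ.≃-Reasoning

⟦⟧-homo-* : ∀ a b → ⟦ a ⟧ * ⟦ b ⟧ ≡ ⟦ a ℕ.* b ⟧
⟦⟧-homo-* a b = toℚᵘ-injective (begin
  toℚᵘ (⟦ a ⟧ * ⟦ b ⟧)                  ≈⟨ toℚᵘ-homo-* ⟦ a ⟧ ⟦ b ⟧ ⟩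
  toℚᵘ ⟦ a ⟧ ℚᵘ.* toℚᵘ ⟦ b ⟧            ≈⟨ ℚᵘ.*-cong (toℚᵘ-/ a 0) (toℚᵘ-/ b 0) ⟩
  ℚᵘ.mkℚᵘ (+ a) 0 ℚᵘ.* ℚᵘ.mkℚᵘ (+ b) 0  ≈⟨ ℚᵘ.*≡* (cong (ℤ._* + 1) (sym (ℤ.pos-* a b))) ⟩
  ℚᵘ.mkℚᵘ (+ (a ℕ.* b)) 0               ≈⟨ toℚᵘ-/ (a ℕ.* b) 0 ⟨
  toℚᵘ ⟦ a ℕ.* b ⟧                      ∎)
  where
  open ℚᵘ.≃-Reasoning

-- Finite sums

sum-*ˡ : ∀ {n} c (f : Vector ℚ n) → sum (λ i → c * f i) ≡ c * sum f
sum-*ˡ c f = sym (*-distribˡ-sum c f)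

sum-mono : ∀ {n} {f g : Vector ℚ n} → (∀ i → f i ≤ g i) → sum f ≤ sum g
sum-mono {ℕ.zero}  f≤g = ≤-refl
sum-mono {ℕ.suc n} f≤g = +-mono-≤ (f≤g zero) (sum-mono (f≤g ∘ suc))

sum-nonNeg : ∀ {n} {f : Vector ℚ n} → (∀ i → 0ℚ ≤ f i) → 0ℚ ≤ sum f
sum-nonNeg {n} {f} 0≤f = subst (_≤ sum f) (sum-replicate-zero n) (sum-mono 0≤f)

sum-nonPos : ∀ {n} {f : Vector ℚ n} → (∀ i → f i ≤ 0ℚ) → sum f ≤ 0ℚ
sum-nonPos {n} {f} f≤0 = subst (sum f ≤_) (sum-replicate-zero n) (sum-mono f≤0)

sum-0 : ∀ {n} {f : Vector ℚ n} → (∀ i → f i ≡ 0ℚ) → sum f ≡ 0ℚ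
sum-0 {n} f≡0 = trans (sum-cong-≗ f≡0) (sum-replicate-zero n)

sum-1 : ∀ n → sum {n} (λ _ → 1ℚ) ≡ ⟦ n ⟧
sum-1 ℕ.zero    = refl
sum-1 (ℕ.suc n) = trans (cong (_+_ 1ℚ) (sum-1 n)) (⟦⟧-suc n)

sum-lin : ∀ {n} a b (f g : Vector ℚ n) →
          sum (λ i → a * f i + b * g i) ≡ a * sum f + b * sum g
sum-lin a b f g = trans (∑-distrib-+ (λ i → a * f i) (λ i → b * g i))
  (cong₂ _+_ (sum-*ˡ a f) (sum-*ˡ b g))

sum-- : ∀ {n} (f g : Vector ℚ n) → sum (λ i → f i - g i) ≡ sum f - sum g
sum-- f g = trans
  (sum-cong-≗ λ i → solve 2 (λ x y → x :- y := con 1ℚ :* x :+ con (- 1ℚ) :* y) refl (f i) (g i))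
  (trans (sum-lin 1ℚ (- 1ℚ) f g)
    (solve 2 (λ x y → con 1ℚ :* x :+ con (- 1ℚ) :* y := x :- y) refl (sum f) (sum g)))

-- All products are nonnegative, so a nonpositive total forces each of them, and after division by
-- `φ i` each `p i`, to be nonpositive.
sum≤0 : ∀ {n} (p φ : Vector ℚ n) → (∀ i → 0ℚ ≤ p i) → (∀ i → 0ℚ < φ i) →
  sum (λ i → p i * φ i) ≤ 0ℚ → sum p ≤ 0ℚ
sum≤0 {ℕ.zero}  p φ 0≤p 0<φ ∑≤0 = ≤-refl
sum≤0 {ℕ.suc n} p φ 0≤p 0<φ ∑≤0 = +-mono-≤ p₀≤0
  (sum≤0 (p ∘ suc) (φ ∘ suc) (0≤p ∘ suc) (0<φ ∘ suc)
    (≤-trans (subst (_≤ p zero * φ zero + rest) (+-identityˡ rest) (+-monoˡ-≤ rest 0≤first)) ∑≤0))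
  where
  rest = sum (λ i → p (suc i) * φ (suc i))
  0≤first : 0ℚ ≤ p zero * φ zero
  0≤first = 0≤* (0≤p zero) (<⇒≤ (0<φ zero))
  first≤0 : p zero * φ zero ≤ 0ℚ
  first≤0 = ≤-trans (subst (_≤ p zero * φ zero + rest) (+-identityʳ (p zero * φ zero))
    (+-monoʳ-≤ (p zero * φ zero) (sum-nonNeg λ i → 0≤* (0≤p (suc i)) (<⇒≤ (0<φ (suc i)))))) ∑≤0
  p₀≤0 : p zero ≤ 0ℚ
  p₀≤0 = *-cancelʳ-≤-pos (φ zero) {{positive (0<φ zero)}}
    (subst (p zero * φ zero ≤_) (sym (*-zeroˡ (φ zero))) first≤0)

-- Averaging: if every `φ i` were positive, `sum≤0` would contradict the positive total weight. It
-- later selects the vertex whose neighbourhood is removed.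
weighted-pigeonhole : ∀ {n} (p φ : Vector ℚ n) → (∀ i → 0ℚ ≤ p i) → 0ℚ < sum p →
  sum (λ i → p i * φ i) ≤ 0ℚ → ∃ λ i → φ i ≤ 0ℚ
weighted-pigeonhole p φ 0≤p 0<∑p ∑≤0 with Fin.any? (λ i → φ i ≤? 0ℚ)
... | yes found = found
... | no ∄ = ⊥-elim (<-irrefl refl
  (<-≤-trans 0<∑p (sum≤0 p φ 0≤p (λ i → ≰⇒> λ φ≤0 → ∄ (i , φ≤0)) ∑≤0)))

∑∑-cong : ∀ {m n} {f g : Fin m → Fin n → ℚ} → (∀ i j → f i j ≡ g i j) →
          sum (λ i → sum (f i)) ≡ sum (λ i → sum (g i))
∑∑-cong f≗g = sum-cong-≗ λ i → sum-cong-≗ (f≗g i)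

∑∑-+ : ∀ {m n} (f g : Fin m → Fin n → ℚ) →
       sum (λ i → sum (λ j → f i j + g i j)) ≡ sum (λ i → sum (f i)) + sum (λ i → sum (g i))
∑∑-+ f g = trans (sum-cong-≗ λ i → ∑-distrib-+ (f i) (g i)) (∑-distrib-+ (sum ∘ f) (sum ∘ g))

∑∑-* : ∀ {m n} c (f : Fin m → Fin n → ℚ) →
       sum (λ i → sum (λ j → c * f i j)) ≡ c * sum (λ i → sum (f i))
∑∑-* c f = trans (sum-cong-≗ λ i → sum-*ˡ c (f i)) (sum-*ˡ c (sum ∘ f))

-- Indicators and cardinalities

𝟙 : Bool → ℚ
𝟙 b = if b then 1ℚ else 0ℚ

𝟙-nonNeg : ∀ b → 0ℚ ≤ 𝟙 b
𝟙-nonNeg true  = 0≤1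
𝟙-nonNeg false = ≤-refl

𝟙≤1 : ∀ b → 𝟙 b ≤ 1ℚ
𝟙≤1 true  = ≤-refl
𝟙≤1 false = 0≤1

∧-does : ∀ b {P : Set} (P? : Dec P) → b ∧ does P? ≡ true → b ≡ true × P
∧-does true (yes p) _ = refl , p

𝟙-∧-¬ : ∀ b {P : Set} (P? : Dec P) → 𝟙 (b ∧ not (does P?)) ≡ 0ℚ ⊎ ¬ P
𝟙-∧-¬ true  (yes _) = inj₁ refl
𝟙-∧-¬ true  (no ¬p) = inj₂ ¬p
𝟙-∧-¬ false _       = inj₁ refl

-- Here `b` stands for membership in the independent set and `c` for having many neighbours in it:
-- the vertices split into that set and the light and heavy vertices outside it.
𝟙-partition : ∀ b c → 𝟙 b + 𝟙 (not b ∧ not c) ≡ 1ℚ - 𝟙 (not b ∧ c)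
𝟙-partition true  _     = refl
𝟙-partition false true  = refl
𝟙-partition false false = refl

𝟙-disjoint : ∀ b c → 𝟙 b + 𝟙 (not b ∧ not c) ≤ 1ℚ
𝟙-disjoint b c = ≤-via (𝟙-nonNeg (not b ∧ c))
  (trans (solve 1 (λ x → x := con 1ℚ :- (con 1ℚ :- x)) refl (𝟙 (not b ∧ c)))
    (cong (λ y → 1ℚ - y) (sym (𝟙-partition b c))))

card : ∀ {n} (A : Subset n) → sum (λ i → 𝟙 (lookup A i)) ≡ ⟦ ∣ A ∣ ⟧
card []          = refl
card (true ∷ A)  = trans (cong (_+_ 1ℚ) (card A)) (⟦⟧-suc ∣ A ∣)
card (false ∷ A) = trans (+-identityˡ _) (card A)

sum≡density : ∀ {n} .{{_ : NonZero n}} (A : Subset n) →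
              sum (λ i → 𝟙 (lookup A i)) ≡ density A * ⟦ n ⟧
sum≡density {n} A = trans (card A) (sym (/-*-cancel ∣ A ∣ n))

-- Adjacency as a symmetric bilinear form

module _ {n : ℕ} (G : Graph n) where

  open Graph G

  adj : Fin n → Fin n → ℚ
  adj u v = 𝟙 (does (u ~? v))

  deg : Vector ℚ n → Vector ℚ n
  deg f u = ∑[ v < n ] (adj u v * f v)

  -- The sum is over ordered pairs: form f f counts every edge twice.
  form : Vector ℚ n → Vector ℚ n → ℚ
  form f g = ∑[ u < n ] ∑[ v < n ] (adj u v * (f u * g v))

  adj-~ : ∀ {u v} → u ~ v → adj u v ≡ 1ℚ
  adj-~ {u} {v} u~v with u ~? v
  ... | yes _  = refl
  ... | no u≁v = ⊥-elim (u≁v u~v)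

  adj-sym : ∀ u v → adj u v ≡ adj v u
  adj-sym u v with u ~? v | v ~? u
  ... | yes _   | yes _   = refl
  ... | no _    | no _    = refl
  ... | yes u~v | no v≁u  = ⊥-elim (v≁u (~-sym u~v))
  ... | no u≁v  | yes v~u = ⊥-elim (u≁v (~-sym v~u))

  adj-cases : ∀ u v → adj u v ≡ 0ℚ ⊎ u ~ v
  adj-cases u v with u ~? v
  ... | yes u~v = inj₂ u~v
  ... | no _    = inj₁ refl

  form-deg : ∀ f g → form f g ≡ ∑[ u < n ] (f u * deg g u)
  form-deg f g = sum-cong-≗ λ u → trans
    (sum-cong-≗ λ v → solve 3 (λ e x y → e :* (x :* y) := x :* (e :* y)) refl (adj u v) (f u) (g v))
    (sum-*ˡ (f u) (λ v → adj u v * g v))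

  form-sym : ∀ f g → form f g ≡ form g f
  form-sym f g = trans (∑-comm λ u v → adj u v * (f u * g v))
    (∑∑-cong λ u v → cong₂ _*_ (adj-sym v u) (*-comm (f v) (g u)))

  form-nonNeg : ∀ {f g} → (∀ u → 0ℚ ≤ f u) → (∀ u → 0ℚ ≤ g u) → 0ℚ ≤ form f g
  form-nonNeg 0≤f 0≤g = sum-nonNeg λ u → sum-nonNeg λ v →
    0≤* (𝟙-nonNeg (does (u ~? v))) (0≤* (0≤f u) (0≤g v))

  form-0 : ∀ {f g} → (∀ {u v} → u ~ v → f u * g v ≡ 0ℚ) → form f g ≡ 0ℚ
  form-0 {f} {g} fg≡0 = sum-0 λ u → sum-0 λ v → term u v
    where
    term : ∀ u v → adj u v * (f u * g v) ≡ 0ℚ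
    term u v with adj-cases u v
    ... | inj₁ e≡0 = trans (cong (_* (f u * g v)) e≡0) (*-zeroˡ (f u * g v))
    ... | inj₂ u~v = trans (cong (adj u v *_) (fg≡0 u~v)) (*-zeroʳ (adj u v))

  form-expand : ∀ f g c → form (λ u → f u + c * g u) (λ u → f u + c * g u) ≡
    form f f + ((c + c) * form g f + (c * c) * form g g)
  form-expand f g c = trans
    (∑∑-cong λ u v → solve 6
      (λ e x y a b c → e :* ((x :+ c :* a) :* (y :+ c :* b))
        := e :* (x :* y) :+ (c :* (e :* (a :* y)) :+ (c :* (e :* (x :* b)) :+ (c :* c) :* (e :* (a :* b)))))
      refl (adj u v) (f u) (f v) (g u) (g v) c)
    (trans (∑∑-+ ff _) (cong (_+_ (form f f))
      (trans (∑∑-+ (λ u v → c * gf u v) _) (trans (cong₂ _+_ (∑∑-* c gf)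
        (trans (∑∑-+ (λ u v → c * fg u v) _)
          (cong₂ _+_ (trans (∑∑-* c fg) (cong (c *_) (form-sym f g))) (∑∑-* (c * c) gg))))
        (solve 3 (λ c x y → c :* x :+ (c :* x :+ (c :* c) :* y) := (c :+ c) :* x :+ (c :* c) :* y)
          refl c (form g f) (form g g))))))
    where
    ff fg gf gg : Fin n → Fin n → ℚ
    ff u v = adj u v * (f u * f v)
    fg u v = adj u v * (f u * g v)
    gf u v = adj u v * (g u * f v)
    gg u v = adj u v * (g u * g v)

  -- The sum over pairs with `u < v` plus its transpose covers each ordered pair of distinct
  -- vertices exactly once, and the diagonal carries no edge.
  edgeSum-form : ∀ μ → edgeSum G μ + edgeSum G μ ≡ form μ μ
  edgeSum-form μ = trans (cong (_+_ (edgeSum G μ)) (∑-comm t))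
    (trans (sym (∑∑-+ t (λ u v → t v u)))
      (∑∑-cong λ u v → sym (trans
        (split (μ u * μ v) (u Fin.<? v) (v Fin.<? u) (u ~? v) (v ~? u))
        (cong (_+_ (t u v)) (cong (λ x → if does ((v Fin.<? u) ×-dec (v ~? u)) then x else 0ℚ)
          (*-comm (μ u) (μ v)))))))
    where
    t : Fin n → Fin n → ℚ
    t u v = if does ((u Fin.<? v) ×-dec (u ~? v)) then μ u * μ v else 0ℚ
    split : ∀ {u v} x (d : Dec (u Fin.< v)) (d′ : Dec (v Fin.< u)) (e : Dec (u ~ v)) (e′ : Dec (v ~ u)) →
      𝟙 (does e) * x ≡ (if does (d ×-dec e) then x else 0ℚ) + (if does (d′ ×-dec e′) then x else 0ℚ)
    split x (yes u<v) (yes v<u) _ _ = ⊥-elim (ℕ.<-asym u<v v<u)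
    split x (yes _) (no _) (yes _) _ = trans (*-identityˡ x) (sym (+-identityʳ x))
    split x (yes _) (no _) (no _)  _ = *-zeroˡ x
    split x (no _) (yes _) (yes _) (yes _) = trans (*-identityˡ x) (sym (+-identityˡ x))
    split x (no _) (yes _) (no _)  (no _)  = *-zeroˡ x
    split x (no _) (yes _) (yes u~v) (no v≁u) = ⊥-elim (v≁u (~-sym u~v))
    split x (no _) (yes _) (no u≁v) (yes v~u) = ⊥-elim (u≁v (~-sym v~u))
    -- Both orders fail only for equal vertices, and then the edge would be a loop.
    split x (no u≮v) (no v≮u) (yes u~v) _ = ⊥-elim
      (~-irrefl (subst (_ ~_) (sym (Fin.toℕ-injective (ℕ.≤-antisym (ℕ.≮⇒≥ v≮u) (ℕ.≮⇒≥ u≮v)))) u~v))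
    split x (no _) (no _) (no _) _ = *-zeroˡ x

  adj≤1 : ∀ u v → adj u v ≤ 1ℚ
  adj≤1 u v = 𝟙≤1 (does (u ~? v))

  -- Halves made of an independent set and a scaled second set

  -- The half is `I + c U`, with `c` chosen to give `U` weight `M`. As the form vanishes on `I`,
  -- twice the edge sum is `2cd + c²q`, where `d = form U I` and `q = form U U`. Since `c ≤ 1`, this
  -- is at most `c (2d + q)`; the sparsity condition says `2d + q ≤ K s`, and `c s = M`.
  spread : ∀ (I U : Vector ℚ n) →
    (∀ u → 0ℚ ≤ I u) → (∀ u → 0ℚ ≤ U u) → (∀ u → I u + U u ≤ 1ℚ) → form I I ≡ 0ℚ →
    0ℚ ≤ ½ * ⟦ n ⟧ - sum I → ½ * ⟦ n ⟧ - sum I ≤ sum U →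
    form U U ≤ ∑[ u < n ] (U u * (sum I - (deg I u + deg I u))) →
    ∃ λ μ → IsHalf μ × edgeSum G μ + edgeSum G μ ≤ sum I * (½ * ⟦ n ⟧ - sum I)
  spread I U 0≤I 0≤U I+U≤1 I-indep 0≤M M≤s sparse with scaling 0≤M M≤s
  ... | c , 0≤c , c≤1 , cs≡M = μ , (bounds , ∑μ) , bound
    where
    μ : Vector ℚ n
    μ u = I u + c * U u
    K M s d q : ℚ
    K = sum I
    M = ½ * ⟦ n ⟧ - K
    s = sum U
    d = form U I
    q = form U U
    bounds : ∀ u → 0ℚ ≤ μ u × μ u ≤ 1ℚ
    bounds u = 0≤+ (0≤I u) (0≤* 0≤c (0≤U u)) ,
      ≤-via (0≤+ (≤⇒0≤ (I+U≤1 u)) (0≤* (≤⇒0≤ c≤1) (0≤U u)))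
        (solve 3 (λ i c x → (con 1ℚ :- (i :+ x)) :+ (con 1ℚ :- c) :* x := con 1ℚ :- (i :+ c :* x))
          refl (I u) c (U u))
    half : ½ * ⟦ n ⟧ ≡ + n / 2
    half = trans (cong (½ *_) (sym (/-*-cancel n 2)))
      (solve 1 (λ x → con ½ :* (x :* con ⟦ 2 ⟧) := x) refl (+ n / 2))
    ∑μ : sum μ ≡ + n / 2
    ∑μ = trans (∑-distrib-+ I (λ u → c * U u))
      (trans (cong (_+_ K) (trans (sum-*ˡ c U) cs≡M))
        (trans (solve 2 (λ k h → k :+ (h :- k) := h) refl K (½ * ⟦ n ⟧)) half))
    weight : ∑[ u < n ] (U u * (K - (deg I u + deg I u))) ≡ K * s - (d + d)
    weight = trans
      (sum-cong-≗ λ u → solve 3 (λ k x a → x :* (k :- (a :+ a)) := k :* x :+ con (- ⟦ 2 ⟧) :* (x :* a))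
        refl K (U u) (deg I u))
      (trans (sum-lin K (- ⟦ 2 ⟧) U (λ u → U u * deg I u))
        (trans (cong (λ x → K * s + - ⟦ 2 ⟧ * x) (sym (form-deg U I)))
          (solve 3 (λ k s d → k :* s :+ con (- ⟦ 2 ⟧) :* d := k :* s :- (d :+ d)) refl K s d)))
    bound : edgeSum G μ + edgeSum G μ ≤ K * M
    -- The slack is `c` times the slack of the sparsity condition plus `c (1 - c) q`, the loss in
    -- replacing `c²` by `c`.
    bound = ≤-via
      (0≤+ (0≤* 0≤c (≤⇒0≤ (subst (q ≤_) weight sparse)))
           (0≤* (0≤* 0≤c (≤⇒0≤ c≤1)) (form-nonNeg 0≤U 0≤U)))
      (trans (solve 5 (λ c k s d q → c :* ((k :* s :- (d :+ d)) :- q) :+ (c :* (con 1ℚ :- c)) :* q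
                := k :* (c :* s) :- (con 0ℚ :+ ((c :+ c) :* d :+ (c :* c) :* q))) refl c K s d q)
        (cong₂ (λ x y → K * x - y) cs≡M
          (sym (trans (edgeSum-form μ) (trans (form-expand I U c)
            (cong (_+ ((c + c) * d + (c * c) * q)) I-indep))))))

  -- Weights inside and outside a neighbourhood

  _∖N_ _∩N_ : Vector ℚ n → Fin n → Vector ℚ n
  (X ∖N w) u = X u * (1ℚ - adj u w)
  (X ∩N w) u = X u * adj u w

  sum-∩N : ∀ X w → sum (X ∩N w) ≡ deg X w
  sum-∩N X w = sum-cong-≗ λ u → trans (*-comm (X u) (adj u w)) (cong (_* X u) (adj-sym u w))

  sum-∖N : ∀ X w → sum (X ∖N w) ≡ sum X - deg X w
  sum-∖N X w = trans
    (sum-cong-≗ λ u → solve 2 (λ x e → x :* (con 1ℚ :- e) := x :- x :* e) refl (X u) (adj u w))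
    (trans (sum-- X (X ∩N w)) (cong (λ y → sum X - y) (sum-∩N X w)))

  -- Triangle-free graphs

  module _ (triangle-free : TriangleFree G) where

    -- Triangle-freeness as a polynomial identity, ready for substitution into ring computations.
    adj-triangle : ∀ u v w → adj u v * (adj u w * adj v w) ≡ 0ℚ
    adj-triangle u v w with adj-cases u v | adj-cases u w | adj-cases v w
    ... | inj₁ e≡0 | _ | _ = trans (cong (_* (adj u w * adj v w)) e≡0)
      (*-zeroˡ (adj u w * adj v w))
    ... | _ | inj₁ e≡0 | _ = trans (cong (λ e → adj u v * (e * adj v w)) e≡0)
      (solve 2 (λ x y → x :* (con 0ℚ :* y) := con 0ℚ) refl (adj u v) (adj v w))
    ... | _ | _ | inj₁ e≡0 = trans (cong (λ e → adj u v * (adj u w * e)) e≡0)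
      (solve 2 (λ x y → x :* (y :* con 0ℚ) := con 0ℚ) refl (adj u v) (adj u w))
    ... | inj₂ u~v | inj₂ u~w | inj₂ v~w = ⊥-elim (triangle-free u~v v~w u~w)

    -- The ends of an edge have no common neighbour, so their neighbourhoods take disjoint parts of
    -- the weight of `I`.
    deg-edge : ∀ {I : Vector ℚ n} → (∀ u → 0ℚ ≤ I u) → ∀ {u v} → u ~ v → deg I u + deg I v ≤ sum I
    deg-edge {I} 0≤I {u} {v} u~v = subst (_≤ sum I)
      (∑-distrib-+ (λ w → adj u w * I w) (λ w → adj v w * I w)) (sum-mono term)
      where
      term : ∀ w → adj u w * I w + adj v w * I w ≤ I w
      -- With `a b = 0` the product `(1 - a) (1 - b)` equals `1 - a - b`. The factor `1ℚ` before
      -- `a b` stands for `adj u v`, which makes `adj-triangle` applicable.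
      term w = ≤-via {(1ℚ - adj u w) * (1ℚ - adj v w) * I w}
        (0≤* (0≤* (≤⇒0≤ (adj≤1 u w)) (≤⇒0≤ (adj≤1 v w))) (0≤I w))
        (trans (solve 3 (λ a b i → (con 1ℚ :- a) :* (con 1ℚ :- b) :* i
                  := (con 1ℚ :* (a :* b)) :* i :+ (i :- (a :* i :+ b :* i))) refl (adj u w) (adj v w) (I w))
          (trans (cong (λ x → x * I w + (I w - (adj u w * I w + adj v w * I w))) zero-product)
            (solve 2 (λ i x → con 0ℚ :* i :+ x := x) refl (I w) (I w - (adj u w * I w + adj v w * I w)))))
        where
        zero-product : 1ℚ * (adj u w * adj v w) ≡ 0ℚ
        zero-product = trans (cong (_* (adj u w * adj v w)) (sym (adj-~ u~v))) (adj-triangle u v w)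

    -- Neighbours of `w` are pairwise nonadjacent, whatever their weights.
    form-∩N : ∀ X w → form (X ∩N w) (X ∩N w) ≡ 0ℚ
    form-∩N X w = sum-0 λ u → sum-0 λ v → trans
      (solve 5 (λ e a b x y → e :* ((x :* a) :* (y :* b)) := (x :* y) :* (e :* (a :* b)))
        refl (adj u v) (adj u w) (adj v w) (X u) (X v))
      (trans (cong (X u * X v *_) (adj-triangle u v w)) (*-zeroʳ (X u * X v)))

    -- A triangle-free graph has no edge inside N(w), so every edge uv of X
    -- contributes 1 − adj u w − adj v w.
    form-∖N : ∀ X w → form (X ∖N w) (X ∖N w) ≡
      ∑[ u < n ] ((1ℚ - (adj u w + adj u w)) * (X u * deg X u))
    form-∖N X w = trans
      (∑∑-cong λ u v → trans
        (solve 5 (λ e a b x y → e :* ((x :* (con 1ℚ :- a)) :* (y :* (con 1ℚ :- b)))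
            := (x :* y) :* (e :* (a :* b))
               :+ (e :* ((x :* (con ½ :- a)) :* y) :+ e :* (x :* (y :* (con ½ :- b)))))
          refl (adj u v) (adj u w) (adj v w) (X u) (X v))
        (trans (cong (λ z → X u * X v * z + (f u v + g u v)) (adj-triangle u v w))
          (solve 2 (λ x y → x :* con 0ℚ :+ y := y) refl (X u * X v) (f u v + g u v))))
      (trans (∑∑-+ f g) (trans (cong (_+_ (form Y X)) (form-sym X Y))
        (trans (cong (λ z → z + z) (form-deg Y X))
          (trans (sym (∑-distrib-+ (λ u → Y u * deg X u) (λ u → Y u * deg X u)))
            (sum-cong-≗ λ u → solve 3
              (λ e x d → x :* (con ½ :- e) :* d :+ x :* (con ½ :- e) :* d
                := (con 1ℚ :- (e :+ e)) :* (x :* d)) refl (adj u w) (X u) (deg X u))))))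
      where
      -- Splitting 1 into two halves writes `1 - a - b` as `(½ - a) + (½ - b)`, so that the two
      -- resulting forms are transposes of each other and `form-sym` merges them.
      Y : Vector ℚ n
      Y u = X u * (½ - adj u w)
      f g : Fin n → Fin n → ℚ
      f u v = adj u v * (Y u * X v)
      g u v = adj u v * (X u * Y v)

    -- Averaging over the removed neighbourhood

    module _ (I X : Vector ℚ n) where

      K : ℚ
      K = sum I

      h : Vector ℚ n
      h u = K - (deg I u + deg I u)

      -- The sparsity condition of `spread` for the part of `X` outside `N(w)` is that this number
      -- is at most zero.
      excess : Vector ℚ n
      excess w = form (X ∖N w) (X ∖N w) - ∑[ u < n ] ((X ∖N w) u * h u)

      -- After the sums are exchanged, `w` occurs only through `I w` and `adj u w * I w`, whose sums
      -- are `K` and `deg I u`. Collecting the terms for a fixed `u` brings out the factor `h u`.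
      sum-excess : ∑[ w < n ] (I w * excess w) ≡
        ∑[ u < n ] (X u * h u * (deg X u - (K - deg I u)))
      sum-excess = trans
        (sum-cong-≗ λ w → trans
          (cong (λ z → I w * (z - ∑[ u < n ] ((X ∖N w) u * h u))) (form-∖N X w))
          (trans (cong (I w *_) (sym (sum-- (f w) (λ u → (X ∖N w) u * h u))))
            (sym (sum-*ˡ (I w) (λ u → f w u - (X ∖N w) u * h u)))))
        (trans (∑-comm λ w u → I w * (f w u - (X ∖N w) u * h u))
          (sum-cong-≗ λ u → trans
            (sum-cong-≗ λ w → solve 5
              (λ i e x d h → i :* ((con 1ℚ :- (e :+ e)) :* (x :* d) :- x :* (con 1ℚ :- e) :* h)
                := x :* (d :- h) :* i :+ x :* (h :- (d :+ d)) :* (e :* i))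
              refl (I w) (adj u w) (X u) (deg X u) (h u))
            (trans (sum-lin (X u * (deg X u - h u)) (X u * (h u - (deg X u + deg X u)))
                I (λ w → adj u w * I w))
              (solve 4 (λ x d k a →
                  x :* (d :- (k :- (a :+ a))) :* k :+ x :* ((k :- (a :+ a)) :- (d :+ d)) :* a
                  := x :* (k :- (a :+ a)) :* (d :- (k :- a)))
                refl (X u) (deg X u) K (deg I u)))))
        where
        f : Fin n → Fin n → ℚ
        f w u = (1ℚ - (adj u w + adj u w)) * (X u * deg X u)

      sum-excess≤0 : (∀ u → 0ℚ ≤ X u) → (∀ u → X u ≡ 0ℚ ⊎ 0ℚ ≤ h u) → (∀ u → deg X u ≤ ½ * K) →
        ∑[ w < n ] (I w * excess w) ≤ 0ℚ
      sum-excess≤0 0≤X X⊆ d≤ = subst (_≤ 0ℚ) (sym sum-excess)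
        (sum-nonPos term)
        where
        term : ∀ u → X u * h u * (deg X u - (K - deg I u)) ≤ 0ℚ
        term u with X⊆ u
        ... | inj₁ x≡0 = ≤-reflexive (trans (cong (λ x → x * h u * (deg X u - (K - deg I u))) x≡0)
          (solve 2 (λ x y → con 0ℚ :* x :* y := con 0ℚ) refl (h u) (deg X u - (K - deg I u))))
        ... | inj₂ 0≤h = ≤-via
          -- The last factor with its sign reversed, `K - deg I u - deg X u`, is
          -- `½ h u + (½ K - deg X u)`, a sum of two nonnegative numbers.
          (0≤* (0≤* (0≤X u) 0≤h) (0≤+ (0≤* 0≤½ 0≤h) (≤⇒0≤ (d≤ u))))
          (solve 4 (λ x d k a → x :* (k :- (a :+ a)) :* (con ½ :* (k :- (a :+ a)) :+ (con ½ :* k :- d))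
              := con 0ℚ :- x :* (k :- (a :+ a)) :* (d :- (k :- a)))
            refl (X u) (deg X u) K (deg I u))

-- A sparse half from a maximum independent set

module _ {n : ℕ} .{{_ : NonZero n}} (G : Graph n) (triangle-free : TriangleFree G)
  (A : Subset n) (A-indep : Independent G A)
  (A-max : ∀ B → Independent G B → density B ≤ density A)
  where

  open Graph G

  private
    I : Vector ℚ n
    I u = 𝟙 (lookup A u)
    κ M : ℚ
    κ = sum I
    M = ½ * ⟦ n ⟧ - κ
    heavy? : ∀ u → Dec (½ * κ < deg G I u)
    heavy? u = ½ * κ <? deg G I u
    X Y : Vector ℚ n
    X u = 𝟙 (not (lookup A u) ∧ not (does (heavy? u)))
    Y u = 𝟙 (not (lookup A u) ∧ does (heavy? u))
    isY : Fin n → Bool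
    isY u = not (lookup A u) ∧ does (heavy? u)
    -- The vector `Y` as a subset, the form in which the maximality of `A` applies to it.
    Y-set : Subset n
    Y-set = tabulate isY

    0≤I : ∀ u → 0ℚ ≤ I u
    0≤I u = 𝟙-nonNeg (lookup A u)
    0≤X : ∀ u → 0ℚ ≤ X u
    0≤X u = 𝟙-nonNeg (not (lookup A u) ∧ not (does (heavy? u)))

  I-indep : form G I I ≡ 0ℚ
  I-indep = form-0 G {I} {I} λ {u} {v} → term u v
    where
    term : ∀ u v → u ~ v → I u * I v ≡ 0ℚ
    term u v u~v with lookup A u in u∈A | lookup A v in v∈A
    ... | true  | true  = ⊥-elim (A-indep u v (lookup⇒[]= u A u∈A) (lookup⇒[]= v A v∈A) u~v)
    ... | true  | false = refl
    ... | false | true  = refl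
    ... | false | false = refl

  -- Adjacent heavy vertices would together have more than `κ` neighbours in `A`, against
  -- `deg-edge`.
  Y-indep : Independent G Y-set
  Y-indep u v u∈Y v∈Y u~v = <-irrefl refl (<-≤-trans
    (subst (_< deg G I u + deg G I v) (solve 1 (λ k → con ½ :* k :+ con ½ :* k := k) refl κ)
      (+-mono-< (heavy u u∈Y) (heavy v v∈Y)))
    (deg-edge G triangle-free 0≤I u~v))
    where
    heavy : ∀ u → u ∈ Y-set → ½ * κ < deg G I u
    heavy u u∈Y = proj₂ (∧-does (not (lookup A u)) (heavy? u)
      (trans (sym (lookup∘tabulate isY u)) ([]=⇒lookup u∈Y)))

  sum-Y≤ : sum Y ≤ κ
  sum-Y≤ = subst₂ _≤_
    (trans (sym (sum≡density Y-set)) (sum-cong-≗ λ u → cong 𝟙 (lookup∘tabulate isY u)))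
    (sym (sum≡density A))
    (*-monoʳ-≤-nonNeg ⟦ n ⟧ {{normalize-nonNeg n 1}} (A-max Y-set Y-indep))

  sum-X : sum X ≡ ⟦ n ⟧ - sum Y - κ
  sum-X = trans (solve 2 (λ k x → x := (k :+ x) :- k) refl κ (sum X))
    (cong (λ z → z - κ) (trans (sym (∑-distrib-+ I X))
      (trans (sum-cong-≗ λ u → 𝟙-partition (lookup A u) (does (heavy? u)))
        (trans (sum-- (λ _ → 1ℚ) Y) (cong (λ z → z - sum Y) (sum-1 n))))))

  -- Maximality of `A` enters through `sum-Y≤`: the weight of `X` is `n - κ - sum Y`, at least
  -- `n - 2κ = 2M`.
  sum-X≥ : M + M ≤ sum X
  sum-X≥ = ≤-via (≤⇒0≤ sum-Y≤)
    (trans (solve 3 (λ k y m → k :- y := (m :- y :- k) :- ((con ½ :* m :- k) :+ (con ½ :* m :- k)))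
        refl κ (sum Y) ⟦ n ⟧)
      (cong (λ z → z - (M + M)) (sym sum-X)))

  light : ∀ u → X u ≡ 0ℚ ⊎ 0ℚ ≤ κ - (deg G I u + deg G I u)
  light u with 𝟙-∧-¬ (not (lookup A u)) (heavy? u)
  ... | inj₁ x≡0 = inj₁ x≡0
  ... | inj₂ ¬heavy = inj₂ (≤-via (0≤+ (≤⇒0≤ (≮⇒≥ ¬heavy)) (≤⇒0≤ (≮⇒≥ ¬heavy)))
    (solve 2 (λ k a → (con ½ :* k :- a) :+ (con ½ :* k :- a) := (k :- (a :+ a)) :- con 0ℚ)
      refl κ (deg G I u)))

  -- `X` lives outside `A`, so for `U ≤ X` the weights `I + U` are at most 1 and `spread` applies.
  spread-light : ∀ U → (∀ u → 0ℚ ≤ U u) → (∀ u → U u ≤ X u) → 0ℚ ≤ M → M ≤ sum U →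
    form G U U ≤ ∑[ u < n ] (U u * (κ - (deg G I u + deg G I u))) →
    ∃ λ μ → IsHalf μ × edgeSum G μ + edgeSum G μ ≤ κ * M
  spread-light U 0≤U U≤X 0≤M M≤ sparse = spread G I U 0≤I 0≤U
    (λ u → ≤-trans (+-monoʳ-≤ (I u) (U≤X u)) (𝟙-disjoint (lookup A u) (does (heavy? u))))
    I-indep 0≤M M≤ sparse

  ∩N≤ : ∀ w u → X u * adj G u w ≤ X u
  ∩N≤ w u = ≤-via (0≤* (0≤X u) (≤⇒0≤ (adj≤1 G u w)))
    (solve 2 (λ x e → x :* (con 1ℚ :- e) := x :- x :* e) refl (X u) (adj G u w))

  ∖N≤ : ∀ w u → X u * (1ℚ - adj G u w) ≤ X u
  ∖N≤ w u = ≤-via (0≤* (0≤X u) (𝟙-nonNeg (does (u ~? w))))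
    (solve 2 (λ x e → x :* e := x :- x :* (con 1ℚ :- e)) refl (X u) (adj G u w))

  sparse-half : 0ℚ ≤ M → M ≤ ½ * κ → 0ℚ < κ →
    ∃ λ μ → IsHalf μ × edgeSum G μ + edgeSum G μ ≤ κ * M
  sparse-half 0≤M M≤½κ 0<κ with Fin.any? (λ w → M ≤? deg G X w)
  -- The chosen part of `X` spans no edge, so its sparsity condition reduces to the right-hand side
  -- being nonnegative, which holds because vertices of `X` are light.
  ... | yes (w , M≤d) = spread-light U (λ u → 0≤* (0≤X u) (𝟙-nonNeg (does (u ~? w)))) (∩N≤ w) 0≤M
    (subst (M ≤_) (sym (sum-∩N G X w)) M≤d)
    (subst (_≤ ∑[ u < n ] (U u * (κ - (deg G I u + deg G I u))))
      (sym (form-∩N G triangle-free X w)) (sum-nonNeg gain))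
    where
    U : Vector ℚ n
    U = _∩N_ G X w
    gain : ∀ u → 0ℚ ≤ U u * (κ - (deg G I u + deg G I u))
    gain u with light u
    ... | inj₁ x≡0 = ≤-reflexive (sym (trans
      (cong (λ x → x * adj G u w * (κ - (deg G I u + deg G I u))) x≡0)
      (solve 2 (λ e h → con 0ℚ :* e :* h := con 0ℚ) refl (adj G u w) (κ - (deg G I u + deg G I u)))))
    ... | inj₂ 0≤h = 0≤* (0≤* (0≤X u) (𝟙-nonNeg (does (u ~? w)))) 0≤h
  -- Now every `deg X w` is at most `M`, so removing any one neighbourhood leaves weight at least
  -- `2M - M`, and `w` is free to be the vertex found by averaging over `A`.
  ... | no ∄ = spread-light (_∖N_ G X w)
    (λ u → 0≤* (0≤X u) (≤⇒0≤ (adj≤1 G u w))) (∖N≤ w) 0≤M M≤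
    (≤-via (0≤+ ≤-refl (neg-antimono-≤ (proj₂ good)))
      (solve 2 (λ f g → con 0ℚ :- (f :- g) := g :- f) refl
        (form G (_∖N_ G X w) (_∖N_ G X w))
        (∑[ u < n ] ((_∖N_ G X w) u * (κ - (deg G I u + deg G I u))))))
    where
    d≤M : ∀ u → deg G X u ≤ M
    d≤M u = <⇒≤ (≰⇒> λ M≤d → ∄ (u , M≤d))
    good : ∃ λ w → excess G triangle-free I X w ≤ 0ℚ
    good = weighted-pigeonhole I (excess G triangle-free I X) 0≤I 0<κ
      (sum-excess≤0 G triangle-free I X 0≤X light (λ u → ≤-trans (d≤M u) M≤½κ))
    w : Fin n
    w = proj₁ good
    M≤ : M ≤ sum (_∖N_ G X w)
    M≤ = subst (M ≤_) (sym (sum-∖N G X w))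
      (≤-via (0≤+ (≤⇒0≤ sum-X≥) (≤⇒0≤ (d≤M w)))
        (solve 3 (λ m x d → (x :- (m :+ m)) :+ (m :- d) := (x :- d) :- m) refl M (sum X) (deg G X w)))

-- Stated for an arbitrary maximum and minimum, because unfolding the searches
-- behind α and β makes type checking infeasible.
min-half-bound : ∀ {n} .{{_ : NonZero n}} (G : Graph n) → TriangleFree G →
  ∀ {a b} → IsMaximum (Independent G) density a → IsMinimum IsHalf β[ G ,_] b →
  + 3 / 8 ≤ a → a ≤ ½ → b ≤ ½ * a * (½ - a)
min-half-bound {n} G triangle-free {a} ((A , A-indep , refl) , A-max) (_ , β-min) 3/8≤α α≤½ =
  ≤-trans (β-min μ μ-half) β≤
  where
  N κ M r : ℚ
  N = ⟦ n ⟧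
  κ = sum (λ u → 𝟙 (lookup A u))
  M = ½ * N - κ
  instance
    n*n≢0 = ℕ.m*n≢0 n n
  r = + 1 / (n ℕ.* n)
  κ≡aN : κ ≡ a * N
  κ≡aN = sum≡density A
  0≤N : 0ℚ ≤ N
  0≤N = nonNegative⁻¹ N {{normalize-nonNeg n 1}}
  0<N : 0ℚ < N
  0<N = positive⁻¹ N {{normalize-pos n 1}}
  0≤M : 0ℚ ≤ M
  0≤M = subst (λ k → 0ℚ ≤ ½ * N - k) (sym κ≡aN)
    (≤-via (0≤* (≤⇒0≤ α≤½) 0≤N)
      (solve 2 (λ a m → (con ½ :- a) :* m := (con ½ :* m :- a :* m) :- con 0ℚ) refl a N))
  M≤½κ : M ≤ ½ * κ
  M≤½κ = subst (λ k → ½ * N - k ≤ ½ * k) (sym κ≡aN)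
    -- Per unit of `N` the slack is `3a/2 - 1/2`, which is `3/2 (a - 3/8) + 1/16`.
    (≤-via (0≤+ (0≤* (0≤* (nonNegative⁻¹ (+ 3 / 2)) (≤⇒0≤ 3/8≤α)) 0≤N)
                (0≤* (nonNegative⁻¹ (+ 1 / 16)) 0≤N))
      (solve 2 (λ a m → con (+ 3 / 2) :* (a :- con (+ 3 / 8)) :* m :+ con (+ 1 / 16) :* m
          := con ½ :* (a :* m) :- (con ½ :* m :- a :* m)) refl a N))
  0<κ : 0ℚ < κ
  0<κ = subst (0ℚ <_) (sym κ≡aN) (<-≤-trans
    (subst (_< (+ 3 / 8) * N) (*-zeroʳ (+ 3 / 8)) (*-monoʳ-<-pos (+ 3 / 8) 0<N))
    (*-monoʳ-≤-nonNeg N {{normalize-nonNeg n 1}} 3/8≤α))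
  sparse : ∃ λ μ → IsHalf μ × edgeSum G μ + edgeSum G μ ≤ κ * M
  sparse = sparse-half G triangle-free A A-indep A-max 0≤M M≤½κ 0<κ
  μ = proj₁ sparse
  μ-half = proj₁ (proj₂ sparse)
  rNN≡1 : r * (N * N) ≡ 1ℚ
  rNN≡1 = trans (cong (r *_) (⟦⟧-homo-* n n)) (/-*-cancel 1 (n ℕ.* n))
  β≤ : r * edgeSum G μ ≤ ½ * a * (½ - a)
  -- The bound on the doubled edge sum is halved and divided by `n²`, with `κ = a N` and
  -- `M = (½ - a) N`.
  β≤ = ≤-via {½ * r * (κ * M - (edgeSum G μ + edgeSum G μ))}
    (0≤* (0≤* 0≤½ (nonNegative⁻¹ r {{normalize-nonNeg 1 (n ℕ.* n)}}))
      (≤⇒0≤ (proj₂ (proj₂ sparse))))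
    (trans (cong (λ k → ½ * r * (k * (½ * N - k) - (edgeSum G μ + edgeSum G μ))) κ≡aN)
      (trans (solve 4 (λ r a m e → con ½ :* r :* (a :* m :* (con ½ :* m :- a :* m) :- (e :+ e))
            := r :* (m :* m) :* (con ½ :* a :* (con ½ :- a)) :- r :* e) refl r a N (edgeSum G μ))
        (cong (λ z → z - r * edgeSum G μ)
          (trans (cong (_* (½ * a * (½ - a))) rNN≡1) (*-identityˡ (½ * a * (½ - a)))))))

theorem3p6 : ∀ (n : ℕ) .{{_ : NonZero n}} (G : Graph n) → TriangleFree G →
    + 3 / 8 ≤ α G → α G ≤ ½ →
    β G ≤ ½ * α G * (½ - α G)
theorem3p6 n G triangle-free = min-half-bound G triangle-free (proj₂ (α-exists G)) (proj₂ (β-exists G))
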